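{- Let $n\geqslant 3$ be an integer and let $q$ be a prime. Let $\vec{a}=(a_1,\ldots,a_n)\in\mathbb{Z}^n$ and $\vec{k}=(k_1,\ldots,k_n)\in\mathbb{Z}^n$ satisfy $$a_i\not\equiv 0 \pmod q,\qquad k_i>0,\qquad k_i\neq k_j \quad (1\leqslant i,j\leqslant n,\ i\neq j),$$ and let $\vec{h}=(h_1,\ldots,h_n)\in\mathbb{N}^n$ satisfy $1\leqslant h_1\leqslant h_2\leqslant\cdots\leqslant h_n$. Then $$\#\mathcal{U}_{n,q}(\vec{a},\vec{k},\vec{h})\ll (h_1h_2h_3)^{1/2}\log q,$$ where the implied constant depends only on $n$ and $\vec{k}$.
   Context: $\mathbb{F}_q$ is identified with $\{0,1,\ldots,q-1\}$. For a real $\zeta$, $\|\zeta\|$ denotes the distance from $\zeta$ to the nearest integer. For $\vec a,\vec k,\vec h$ as in the claim, $\mathcal{U}_{n,q}(\vec{a},\vec{k},\vec{h})$ denotes the set of $u\in\mathbb{F}_q$ for which the Bohr set $$\{s\in\mathbb{F}_q:\ \|a_j u^{k_j} s/q\|\leqslant h_j/q,\ j=1,\ldots,n\}$$ is nontrivial (i.e. contains some $s\neq 0$); equivalently, the set of $u\in\mathbb{F}_q$ for which there exist $s\in\{1,\ldots,q-1\}$ and integers $x_1,\ldots,x_n$ with $|x_j|\leqslant h_j$ and $s a_j u^{k_j}\equiv x_j \pmod q$ for $j=1,\ldots,n$. The notation $A\ll B$ means $|A|\leqslant cB$ for a constant $c>0$. -}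

module Defs where

open import Data.Nat using (ℕ; zero; suc; _+_; _*_; _∸_; _^_; _≤_; _≤?_; _⊓_; NonZero)
open import Data.Integer using (ℤ; _%ℕ_)
open import Data.Fin using (Fin)
open import Data.Fin.Properties using (all?)
open import Data.List using (List; length; filter; upTo; map)
open import Data.List.Relation.Unary.Any using (Any; any?)
open import Relation.Nullary using (Dec)

-- ‖ m / q ‖ · q  : distance (scaled by q) of m/q to the nearest integer,
-- for a natural number m; equals min(m mod q, q - m mod q).
distq : (q : ℕ) → .{{NonZero q}} → ℕ → ℕ
distq q m = (m Data.Nat.% q) ⊓ (q ∸ (m Data.Nat.% q))

-- the j-th Bohr condition  ‖ a_j u^{k_j} s / q ‖ ≤ h_j / q
-- (a_j is reduced mod q first, which does not change the residue)
BohrCond : {n : ℕ} (q : ℕ) → .{{NonZero q}} →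
           (a : Fin n → ℤ) (k h : Fin n → ℕ) (u s : ℕ) → Fin n → Set
BohrCond q a k h u s j = distq q ((a j %ℕ q) * (u ^ k j) * s) ≤ h j

BohrCond? : {n : ℕ} (q : ℕ) → .{{_ : NonZero q}} →
            (a : Fin n → ℤ) (k h : Fin n → ℕ) (u s : ℕ) → (j : Fin n) →
            Dec (BohrCond q a k h u s j)
BohrCond? q a k h u s j = distq q ((a j %ℕ q) * (u ^ k j) * s) ≤? h j

nonzeroFq : ℕ → List ℕ
nonzeroFq q = map suc (upTo (q ∸ 1))

InU : {n : ℕ} (q : ℕ) → .{{NonZero q}} →
      (a : Fin n → ℤ) (k h : Fin n → ℕ) (u : ℕ) → Set
InU q a k h u = Any (λ s → ∀ j → BohrCond q a k h u s j) (nonzeroFq q)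

InU? : {n : ℕ} (q : ℕ) → .{{_ : NonZero q}} →
       (a : Fin n → ℤ) (k h : Fin n → ℕ) (u : ℕ) → Dec (InU q a k h u)
InU? q a k h u = any? (λ s → all? (BohrCond? q a k h u s)) (nonzeroFq q)

#U : {n : ℕ} (q : ℕ) → .{{NonZero q}} →
     (a : Fin n → ℤ) (k h : Fin n → ℕ) → ℕ
#U q a k h = length (filter (InU? q a k h) (upTo q))

{-# OPTIONS --safe #-}
module Submission where

-- Let P = h₁ h₂ h₃ and let u ∈ U, so that some s ≢ 0 makes s (a₁ u^k₁, a₂ u^k₂, a₃ u^k₃) congruent
-- to an integer vector x with |xⱼ| ≤ hⱼ.  By the pigeonhole principle a box of sides Wⱼ with
-- (W₁ + 1)(W₂ + 1)(W₃ + 1) > 1 + ∑ Wⱼ hⱼ contains two vectors with the same scalar product with x;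
-- their difference e is nonzero with |eⱼ| ≤ Wⱼ and e · x = 0.  Hence u is a root modulo q of
-- ∑ eⱼ aⱼ X^kⱼ, which is not the zero polynomial if Wⱼ < q, and so #U ≪ ∏ (2 Wⱼ + 1).
-- If h₃ ≤ h₁ h₂ take Wⱼ ≈ 2 √P / hⱼ, otherwise W = (2 h₂, 2 h₁, 0): the product is ≪ √P.
-- These Wⱼ are smaller than q unless q² ≤ 16 P, when the bound #U ≤ q suffices.

open import Defs
open import Data.Nat as ℕ using (ℕ; zero; suc; _≤_; _<_; _∸_; z≤n; s≤s; NonZero)
import Data.Nat.Properties as ℕ
import Data.Nat.Divisibility as ℕ
import Data.Nat.DivMod as ℕ
open import Data.Nat.Primality using (Prime; prime⇒nonZero; prime⇒nonTrivial; euclidsLemma)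
open import Data.Nat.Logarithm using (⌊log₂_⌋; ⌊log₂⌋-mono-≤; ⌊log₂[2^n]⌋≡n)
open import Data.Integer using (ℤ; +_; _%ℕ_; _/ℕ_)
import Data.Integer.Properties as ℤ
open import Data.Integer.Divisibility using (_∣_)
open import Data.Integer.Divisibility.Signed using (divides; ∣ᵤ⇒∣; ∣⇒∣ᵤ; ∣m∣n⇒∣m+n; ∣m⇒∣-m; ∣m+n∣m⇒∣n; ∣m+n∣n⇒∣m; ∣n⇒∣m*n) renaming (_∣_ to _∣ₛ_)
open import Data.Integer.DivMod using (a≡a%ℕn+[a/ℕn]*n)
open import Data.List using (List; []; _∷_; length; map; filter; upTo; cartesianProduct)
open import Data.List.Properties using (length-map; length-++; length-upTo; length-filter)
open import Data.List.Membership.Propositional using (_∈_; find; lose)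
open import Data.List.Membership.Propositional.Properties using (∈-map⁺; ∈-map⁻; ∈-upTo⁺; ∈-upTo⁻; ∈-cartesianProduct⁺)
open import Data.List.Relation.Unary.All as All using (All; []; _∷_)
import Data.List.Relation.Unary.All.Properties as All
open import Data.List.Relation.Unary.AllPairs using (AllPairs; []; _∷_)
import Data.List.Relation.Unary.AllPairs.Properties as AllPairs
open import Data.List.Relation.Unary.Any using (Any; here; there)
open import Data.List.Relation.Binary.Sublist.Propositional using (_⊆_; []; _∷_; _∷ʳ_)
open import Data.List.Relation.Binary.Sublist.Propositional.Properties using (All-resp-⊆)
open import Data.Fin using (Fin; zero; suc; toℕ; fromℕ<; remQuot; combine)
import Data.Fin.Properties as Fin
open import Data.Product using (∃₂; ∃-syntax; _×_; _,_; proj₁; proj₂)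
open import Data.Sum using (_⊎_; inj₁; inj₂)
open import Data.Empty using (⊥-elim)
open import Function using (_∘_; id)
open import Relation.Nullary using (¬_; yes; no)
open import Relation.Binary.PropositionalEquality using (_≡_; _≢_; refl; sym; trans; cong; cong₂; subst; module ≡-Reasoning)

module _ where

  open import Data.Integer using (_+_; _-_; _*_; -_; 0ℤ; ∣_∣)
  open import Data.Integer.Tactic.RingSolver using (solve-∀)

  -- Polynomials modulo a prime

  -- The first argument is the number of coefficients read, so the degree is below `n`. With
  -- coefficients given as a function on all of ℕ, passing to the tail of a polynomial is
  -- composition with `suc`.
  evalP : ℕ → (ℕ → ℤ) → ℤ → ℤ
  evalP zero    c x = 0ℤ
  evalP (suc n) c x = c 0 + x * evalP n (c ∘ suc) x

  evalP-+ : ∀ n c d x → evalP n (λ i → c i + d i) x ≡ evalP n c x + evalP n d x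
  evalP-+ zero    c d x = refl
  evalP-+ (suc n) c d x =
    trans (cong (λ z → c 0 + d 0 + x * z) (evalP-+ n (c ∘ suc) (d ∘ suc) x))
          (lem (c 0) (d 0) x (evalP n (c ∘ suc) x) (evalP n (d ∘ suc) x))
    where
    lem : ∀ a b x y z → a + b + x * (y + z) ≡ (a + x * y) + (b + x * z)
    lem = solve-∀

  evalP-0 : ∀ n x → evalP n (λ _ → 0ℤ) x ≡ 0ℤ
  evalP-0 zero    x = refl
  evalP-0 (suc n) x = trans (ℤ.+-identityˡ _) (trans (cong (x *_) (evalP-0 n x)) (ℤ.*-zeroʳ x))

  monomial : ℕ → ℤ → ℕ → ℤ
  monomial zero    a zero    = a
  monomial zero    a (suc i) = 0ℤ
  monomial (suc k) a zero    = 0ℤ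
  monomial (suc k) a (suc i) = monomial k a i

  monomial-≡ : ∀ k a → monomial k a k ≡ a
  monomial-≡ zero    a = refl
  monomial-≡ (suc k) a = monomial-≡ k a

  monomial-≢ : ∀ k a i → k ≢ i → monomial k a i ≡ 0ℤ
  monomial-≢ zero    a zero    k≢i = ⊥-elim (k≢i refl)
  monomial-≢ zero    a (suc i) k≢i = refl
  monomial-≢ (suc k) a zero    k≢i = refl
  monomial-≢ (suc k) a (suc i) k≢i = monomial-≢ k a i (k≢i ∘ cong suc)

  evalP-monomial : ∀ n k a u → k < n → evalP n (monomial k a) (+ u) ≡ a * + (u ℕ.^ k)
  evalP-monomial (suc n) zero    a u _ =
    trans (cong (λ z → a + + u * z) (evalP-0 n (+ u))) (lem a (+ u))
    where
    lem : ∀ a x → a + x * 0ℤ ≡ a * + 1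
    lem = solve-∀
  evalP-monomial (suc n) (suc k) a u (s≤s k<n) =
    trans (cong (λ z → 0ℤ + + u * z) (evalP-monomial n k a u k<n))
    (trans (lem a (+ u) (+ (u ℕ.^ k))) (cong (a *_) (sym (ℤ.pos-* u (u ℕ.^ k)))))
    where
    lem : ∀ a x y → 0ℤ + x * (a * y) ≡ a * (x * y)
    lem = solve-∀

  -- Horner's scheme: the i-th coefficient of (p(x) − p(r)) / (x − r) is the value at r of the i-th tail of p.
  quotientP : ℕ → (ℕ → ℤ) → ℤ → ℕ → ℤ
  quotientP n c r zero    = evalP n (c ∘ suc) r
  quotientP n c r (suc i) = quotientP (ℕ.pred n) (c ∘ suc) r i

  quotientP-correct : ∀ n c r x →
    evalP (suc n) c x ≡ evalP (suc n) c r + (x - r) * evalP n (quotientP n c r) x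
  quotientP-correct zero    c r x = lem (c 0) x r
    where
    lem : ∀ a x r → a + x * 0ℤ ≡ a + r * 0ℤ + (x - r) * 0ℤ
    lem = solve-∀
  quotientP-correct (suc n) c r x =
    trans (cong (λ z → c 0 + x * z) (quotientP-correct n (c ∘ suc) r x))
          (lem (c 0) x r (evalP (suc n) (c ∘ suc) r) (evalP n (quotientP n (c ∘ suc) r) x))
    where
    lem : ∀ a x r y z → a + x * (y + (x - r) * z) ≡ a + r * y + (x - r) * (y + x * z)
    lem = solve-∀

  -- The value at `r` is `c 0` plus `r` times the first coefficient of the quotient, so `d` divides
  -- `c 0`. That same coefficient is the value of the tail at `r`, and the remaining ones form the
  -- quotient of the tail, so the argument repeats on `c ∘ suc`.
  quotientP-vanishes : ∀ {d} n c r → d ∣ₛ evalP (suc n) c r → (∀ i → i < n → d ∣ₛ quotientP n c r i) →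
    ∀ i → i < suc n → d ∣ₛ c i
  quotientP-vanishes zero    c r d∣p d∣g zero    i<n =
    ∣m+n∣n⇒∣m d∣p (subst (_ ∣ₛ_) (sym (ℤ.*-zeroʳ r)) (divides 0ℤ refl))
  quotientP-vanishes zero    c r d∣p d∣g (suc i) (s≤s ())
  quotientP-vanishes (suc n) c r d∣p d∣g zero    i<n =
    ∣m+n∣n⇒∣m d∣p (∣n⇒∣m*n r (d∣g 0 (s≤s z≤n)))
  quotientP-vanishes (suc n) c r d∣p d∣g (suc i) (s≤s i<n) =
    quotientP-vanishes n (c ∘ suc) r (d∣g 0 (s≤s z≤n)) (λ j j<n → d∣g (suc j) (s≤s j<n)) i i<n

  ∣-cancelˡ : ∀ {q} → Prime q → ∀ x {y} → ¬ (+ q ∣ₛ x) → + q ∣ₛ x * y → + q ∣ₛ y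
  ∣-cancelˡ {q} qp x {y} q∤x q∣xy
    with euclidsLemma ∣ x ∣ ∣ y ∣ qp (subst (q ℕ.∣_) (ℤ.abs-* x y) (∣⇒∣ᵤ q∣xy))
  ... | inj₁ q∣x = ⊥-elim (q∤x (∣ᵤ⇒∣ q∣x))
  ... | inj₂ q∣y = ∣ᵤ⇒∣ q∣y

  -- Induction on the number of coefficients: dividing by `x - r` for the first root `r` removes one
  -- coefficient. The other roots stay roots of the quotient, because the prime `q` does not divide
  -- `x - r`.
  lagrange : ∀ {q} → Prime q → ∀ n c xs → AllPairs (λ x y → ¬ (+ q ∣ₛ y - x)) xs →
    All (λ x → + q ∣ₛ evalP n c x) xs → n ≤ length xs → ∀ i → i < n → + q ∣ₛ c i
  lagrange qp zero    c xs       ap        al          n≤  i ()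
  lagrange {q} qp (suc n) c (r ∷ xs) (dr ∷ ap) (q∣r ∷ al) (s≤s n≤) =
    quotientP-vanishes n c r q∣r (lagrange qp n (quotientP n c r) xs ap (All.zipWith step (dr , al)) n≤)
    where
    step : ∀ {x} → (¬ (+ q ∣ₛ x - r)) × + q ∣ₛ evalP (suc n) c x → + q ∣ₛ evalP n (quotientP n c r) x
    step {x} (q∤ , q∣x) = ∣-cancelˡ qp (x - r) q∤
      (∣m+n∣m⇒∣n (subst (+ q ∣ₛ_) (quotientP-correct n c r x) q∣x) q∣r)

  -- Counting through a relation with small fibres

  AllPairs-resp-⊆ : ∀ {A : Set} {S : A → A → Set} {xs ys : List A} → ys ⊆ xs → AllPairs S xs → AllPairs S ys
  AllPairs-resp-⊆ []         []       = []
  AllPairs-resp-⊆ (_ ∷ʳ p)   (_ ∷ ap) = AllPairs-resp-⊆ p ap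
  AllPairs-resp-⊆ (refl ∷ p) (a ∷ ap) = All-resp-⊆ p a ∷ AllPairs-resp-⊆ p ap

  All-⊎-split : ∀ {A : Set} {P Q : A → Set} {xs : List A} → All (λ x → P x ⊎ Q x) xs →
    ∃₂ λ ys zs → ys ⊆ xs × zs ⊆ xs × All P ys × All Q zs × length xs ≡ length ys ℕ.+ length zs
  All-⊎-split [] = [] , [] , [] , [] , [] , [] , refl
  All-⊎-split {xs = x ∷ _} (inj₁ p ∷ al) with All-⊎-split al
  ... | ys , zs , s , t , ps , qs , eq = x ∷ ys , zs , refl ∷ s , x ∷ʳ t , p ∷ ps , qs , cong suc eq
  All-⊎-split {xs = x ∷ _} (inj₂ q ∷ al) with All-⊎-split al
  ... | ys , zs , s , t , ps , qs , eq =
    ys , x ∷ zs , x ∷ʳ s , refl ∷ t , ps , q ∷ qs , trans (cong suc eq) (sym (ℕ.+-suc (length ys) (length zs)))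

  -- A union bound over `bs`: the entries related to the head are split off and bounded by `K`, the
  -- others go to the recursion. The fibre bound holds only for pairwise `S`-related lists (later:
  -- pairwise incongruent), and both halves inherit this because they are sublists.
  length-≤-fibres : ∀ {A B : Set} {S : A → A → Set} {R : A → B → Set} {K} →
    (∀ b xs → AllPairs S xs → All (λ x → R x b) xs → length xs ≤ K) →
    ∀ bs xs → AllPairs S xs → All (λ x → Any (R x) bs) xs → length xs ≤ length bs ℕ.* K
  length-≤-fibres fib []       []       ap []       = z≤n
  length-≤-fibres fib []       (x ∷ xs) ap (() ∷ _)
  length-≤-fibres {R = R} {K} fib (b ∷ bs) xs ap al
    with All-⊎-split {P = λ x → R x b} {Q = λ x → Any (R x) bs}
           (All.map (λ { (here r) → inj₁ r ; (there r) → inj₂ r }) al)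
  ... | ys , zs , s , t , ps , qs , eq = ℕ.≤-trans (ℕ.≤-reflexive eq)
    (ℕ.+-mono-≤ (fib b ys (AllPairs-resp-⊆ s ap) ps)
                (length-≤-fibres fib bs zs (AllPairs-resp-⊆ t ap) qs))

  length-cartesianProduct : ∀ {A B : Set} (xs : List A) (ys : List B) →
    length (cartesianProduct xs ys) ≡ length xs ℕ.* length ys
  length-cartesianProduct []       ys = refl
  length-cartesianProduct (x ∷ xs) ys = trans (length-++ (map (x ,_) ys))
    (cong₂ ℕ._+_ (length-map (x ,_) ys) (length-cartesianProduct xs ys))

  -- Small residues

  -- An integer of absolute value at most `h` is written as a difference of two naturals at most
  -- `h`. This lets the pigeonhole argument work with natural numbers and without cases on signs.
  SmallResidue : ℕ → ℕ → ℕ → Set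
  SmallResidue q h m = ∃₂ λ p n → p ≤ h × n ≤ h × + q ∣ₛ + m - (+ p - + n)

  distq⇒small : ∀ q .{{_ : NonZero q}} {h} m → distq q m ≤ h → SmallResidue q h m
  distq⇒small q {h} m d≤h with ℕ.≤-total (m ℕ.% q) (q ∸ m ℕ.% q)
  ... | inj₁ r≤ = m ℕ.% q , 0 , subst (_≤ h) (ℕ.m≤n⇒m⊓n≡m r≤) d≤h , z≤n , divides (+ (m ℕ./ q)) eq
    where
    lem : ∀ r t → r + t - (r - + 0) ≡ t
    lem = solve-∀
    eq : + m - (+ (m ℕ.% q) - + 0) ≡ + (m ℕ./ q) * + q
    eq = trans (cong (λ z → z - (+ (m ℕ.% q) - + 0))
                 (trans (cong +_ (ℕ.m≡m%n+[m/n]*n m q)) (ℤ.pos-+ (m ℕ.% q) _)))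
               (trans (lem (+ (m ℕ.% q)) (+ (m ℕ./ q ℕ.* q))) (ℤ.pos-* (m ℕ./ q) q))
  -- The nearest multiple of `q` is taken above `m`: the small representative is minus `q ∸ m % q`,
  -- and the quotient goes up by one.
  ... | inj₂ ≤r = 0 , q ∸ m ℕ.% q , z≤n , subst (_≤ h) (ℕ.m≥n⇒m⊓n≡n ≤r) d≤h , divides (+ (m ℕ./ q) + + 1) eq
    where
    r = m ℕ.% q
    lem : ∀ r t d → r + t - (+ 0 - d) ≡ t + (r + d)
    lem = solve-∀
    lem2 : ∀ t q → t * q + q ≡ (t + + 1) * q
    lem2 = solve-∀
    eq : + m - (+ 0 - + (q ∸ r)) ≡ (+ (m ℕ./ q) + + 1) * + q
    eq = trans (cong (λ z → z - (+ 0 - + (q ∸ r)))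
                 (trans (cong +_ (ℕ.m≡m%n+[m/n]*n m q)) (ℤ.pos-+ r _)))
        (trans (lem (+ r) (+ (m ℕ./ q ℕ.* q)) (+ (q ∸ r)))
        (trans (cong₂ _+_ (ℤ.pos-* (m ℕ./ q) q)
                  (trans (sym (ℤ.pos-+ r (q ∸ r))) (cong +_ (ℕ.m+[n∸m]≡n (ℕ.<⇒≤ (ℕ.m%n<n m q))))))
               (lem2 (+ (m ℕ./ q)) (+ q))))

  ∣-⇒≤ : ∀ {q u v} → u < q → v ≤ u → + q ∣ₛ + u - + v → u ≤ v
  ∣-⇒≤ {q} {u} {v} u<q v≤u q∣
    with u ∸ v in eq | subst (λ t → q ℕ.∣ ∣ t ∣) (trans (ℤ.[+m]-[+n]≡m⊖n u v) (ℤ.⊖-≥ v≤u)) (∣⇒∣ᵤ q∣)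
  ... | zero  | _   = ℕ.m∸n≡0⇒m≤n eq
  ... | suc d | q∣d =
    ⊥-elim (ℕ.<⇒≱ (subst (_< q) eq (ℕ.≤-<-trans (ℕ.m∸n≤m u v) u<q)) (ℕ.∣⇒≤ q∣d))

  ∣-⇒≡ : ∀ {q u v} → u < q → v < q → + q ∣ₛ + u - + v → u ≡ v
  ∣-⇒≡ {q} {u} {v} u<q v<q q∣ with ℕ.≤-total u v
  ... | inj₂ v≤u = ℕ.≤-antisym (∣-⇒≤ u<q v≤u q∣) v≤u
  ... | inj₁ u≤v = ℕ.≤-antisym u≤v (∣-⇒≤ v<q u≤v (subst (+ q ∣ₛ_) (lem (+ u) (+ v)) (∣m⇒∣-m q∣)))
    where
    lem : ∀ x y → - (x - y) ≡ y - x
    lem = solve-∀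

  -- Vectors orthogonal to a small vector

  -- The values of `t` lie in `Fin (suc B)`, and mixed-radix coding turns the box into a single
  -- `Fin`, where the pigeonhole principle for `Fin` applies.
  box-pigeonhole : ∀ {M N L B} (t : Fin M × Fin N × Fin L → ℕ) → (∀ w → t w ≤ B) →
    suc B < M ℕ.* (N ℕ.* L) → ∃₂ λ w w′ → w ≢ w′ × t w ≡ t w′
  box-pigeonhole {M} {N} {L} {B} t t≤B B< =
    let i , j , i<j , eq = Fin.pigeonhole B< (λ i → fromℕ< (s≤s (t≤B (decode i))))
    in decode i , decode j , (λ di≡dj → Fin.<⇒≢ i<j (decode-injective i j di≡dj)) ,
       Fin.fromℕ<-injective _ _ _ _ eq
    where
    decode : Fin (M ℕ.* (N ℕ.* L)) → Fin M × Fin N × Fin L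
    decode i = proj₁ (remQuot {M} (N ℕ.* L) i) , remQuot L (proj₂ (remQuot {M} (N ℕ.* L) i))
    encode : Fin M × Fin N × Fin L → Fin (M ℕ.* (N ℕ.* L))
    encode (a , b , c) = combine a (combine b c)
    encode-decode : ∀ i → encode (decode i) ≡ i
    encode-decode i =
      trans (cong (combine {M} (proj₁ (remQuot {M} (N ℕ.* L) i))) (Fin.combine-remQuot {N} L (proj₂ (remQuot {M} (N ℕ.* L) i))))
            (Fin.combine-remQuot {M} (N ℕ.* L) i)
    decode-injective : ∀ i j → decode i ≡ decode j → i ≡ j
    decode-injective i j eq = trans (sym (encode-decode i)) (trans (cong encode eq) (encode-decode j))

  -- w (p − n) + W n, a natural number not exceeding W h when w ≤ W and p, n ≤ h.
  shifted : ℕ → ℕ → ℕ → ℕ → ℕ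
  shifted W p n w = w ℕ.* p ℕ.+ (W ∸ w) ℕ.* n

  shifted-≤ : ∀ {W p n w h} → w ≤ W → p ≤ h → n ≤ h → shifted W p n w ≤ W ℕ.* h
  shifted-≤ {W} {p} {n} {w} {h} w≤W p≤h n≤h = ℕ.≤-trans
    (ℕ.+-mono-≤ (ℕ.*-monoʳ-≤ w p≤h) (ℕ.*-monoʳ-≤ (W ∸ w) n≤h))
    (ℕ.≤-reflexive (trans (sym (ℕ.*-distribʳ-+ h w (W ∸ w))) (cong (ℕ._* h) (ℕ.m+[n∸m]≡n w≤W))))

  -- The shift `+ W * + n` does not depend on `w`, so it cancels when two values are compared.
  shifted-ℤ : ∀ {W p n w} → w ≤ W → + shifted W p n w ≡ + w * (+ p - + n) + + W * + n
  shifted-ℤ {W} {p} {n} {w} w≤W = begin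
    + (w ℕ.* p ℕ.+ (W ∸ w) ℕ.* n)                  ≡⟨ ℤ.pos-+ (w ℕ.* p) _ ⟩
    + (w ℕ.* p) + + ((W ∸ w) ℕ.* n)                ≡⟨ cong₂ _+_ (ℤ.pos-* w p) (ℤ.pos-* (W ∸ w) n) ⟩
    + w * + p + + (W ∸ w) * + n                    ≡⟨ lem (+ w) (+ p) (+ n) (+ (W ∸ w)) ⟩
    + w * (+ p - + n) + (+ w + + (W ∸ w)) * + n    ≡⟨ cong (λ z → + w * (+ p - + n) + z * + n) w+ ⟩
    + w * (+ p - + n) + + W * + n                  ∎
    where
    open ≡-Reasoning
    lem : ∀ w p n d → w * p + d * n ≡ w * (p - n) + (w + d) * n
    lem = solve-∀
    w+ : + w + + (W ∸ w) ≡ + W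
    w+ = trans (sym (ℤ.pos-+ w (W ∸ w))) (cong +_ (ℕ.m+[n∸m]≡n w≤W))

  pairing : ℤ × ℤ × ℤ → ℤ × ℤ × ℤ → ℤ
  pairing (e₁ , e₂ , e₃) (x₁ , x₂ , x₃) = e₁ * x₁ + e₂ * x₂ + e₃ * x₃

  difference : ∀ {M N L} → Fin M × Fin N × Fin L → Fin M × Fin N × Fin L → ℤ × ℤ × ℤ
  difference (i , j , l) (i′ , j′ , l′) = + toℕ i - + toℕ i′ , + toℕ j - + toℕ j′ , + toℕ l - + toℕ l′

  pairing-difference : ∀ u v w u′ v′ w′ x y z c d e →
    u * x + c + (v * y + d) + (w * z + e) ≡ u′ * x + c + (v′ * y + d) + (w′ * z + e) →
    pairing (u - u′ , v - v′ , w - w′) (x , y , z) ≡ 0ℤ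
  pairing-difference u v w u′ v′ w′ x y z c d e eq = begin
    (u - u′) * x + (v - v′) * y + (w - w′) * z
      ≡⟨ cong₂ _+_ (cong₂ _+_ (term u u′ x c) (term v v′ y d)) (term w w′ z e) ⟩
    ((u * x + c) - (u′ * x + c)) + ((v * y + d) - (v′ * y + d)) + ((w * z + e) - (w′ * z + e))
      ≡⟨ regroup (u * x + c) (v * y + d) (w * z + e) (u′ * x + c) (v′ * y + d) (w′ * z + e) ⟩
    (u * x + c + (v * y + d) + (w * z + e)) - (u′ * x + c + (v′ * y + d) + (w′ * z + e))
      ≡⟨ ℤ.i≡j⇒i-j≡0 eq ⟩
    0ℤ ∎
    where
    open ≡-Reasoning
    term : ∀ u u′ x c → (u - u′) * x ≡ (u * x + c) - (u′ * x + c)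
    term = solve-∀
    regroup : ∀ a b c a′ b′ c′ → (a - a′) + (b - b′) + (c - c′) ≡ (a + b + c) - (a′ + b′ + c′)
    regroup = solve-∀

  -- The combination of the three congruences with coefficients `e`, `f`, `g` says that `s` times
  -- the pairing with `(m , n , o)` is congruent to the pairing with `(x , y , z)`, which is zero.
  pairing-∣ : ∀ {d} s e f g x y z m n o → d ∣ₛ m * s - x → d ∣ₛ n * s - y → d ∣ₛ o * s - z →
    pairing (e , f , g) (x , y , z) ≡ 0ℤ → d ∣ₛ s * pairing (e , f , g) (m , n , o)
  pairing-∣ {d} s e f g x y z m n o dx dy dz orth =
    subst (d ∣ₛ_) eq (∣m∣n⇒∣m+n (∣m∣n⇒∣m+n (∣n⇒∣m*n e dx) (∣n⇒∣m*n f dy)) (∣n⇒∣m*n g dz))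
    where
    open ≡-Reasoning
    term : ∀ e m s x → e * (m * s - x) ≡ s * (e * m) - e * x
    term = solve-∀
    regroup : ∀ s a b c x y z → (s * a - x) + (s * b - y) + (s * c - z) ≡ s * (a + b + c) - (x + y + z)
    regroup = solve-∀
    eq : e * (m * s - x) + f * (n * s - y) + g * (o * s - z) ≡ s * (e * m + f * n + g * o)
    eq = begin
      e * (m * s - x) + f * (n * s - y) + g * (o * s - z)
        ≡⟨ cong₂ _+_ (cong₂ _+_ (term e m s x) (term f n s y)) (term g o s z) ⟩
      (s * (e * m) - e * x) + (s * (f * n) - f * y) + (s * (g * o) - g * z)
        ≡⟨ regroup s (e * m) (f * n) (g * o) (e * x) (f * y) (g * z) ⟩
      s * (e * m + f * n + g * o) - (e * x + f * y + g * z)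
        ≡⟨ cong (λ t → s * (e * m + f * n + g * o) - t) orth ⟩
      s * (e * m + f * n + g * o) - 0ℤ
        ≡⟨ ℤ.+-identityʳ _ ⟩
      s * (e * m + f * n + g * o) ∎

  orthogonal-difference : ∀ {W₁ W₂ W₃ h₁ h₂ h₃ p₁ p₂ p₃ n₁ n₂ n₃} →
    p₁ ≤ h₁ → n₁ ≤ h₁ → p₂ ≤ h₂ → n₂ ≤ h₂ → p₃ ≤ h₃ → n₃ ≤ h₃ →
    suc (W₁ ℕ.* h₁ ℕ.+ W₂ ℕ.* h₂ ℕ.+ W₃ ℕ.* h₃) < suc W₁ ℕ.* (suc W₂ ℕ.* suc W₃) →
    ∃₂ λ (w w′ : Fin (suc W₁) × Fin (suc W₂) × Fin (suc W₃)) → w ≢ w′ ×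
      pairing (difference w w′) (+ p₁ - + n₁ , + p₂ - + n₂ , + p₃ - + n₃) ≡ 0ℤ
  orthogonal-difference {W₁} {W₂} {W₃} {h₁} {h₂} {h₃} {p₁} {p₂} {p₃} {n₁} {n₂} {n₃} a a′ b b′ c c′ B< =
    let w , w′ , w≢w′ , eq = box-pigeonhole t t≤ B<
    in w , w′ , w≢w′ , orth w w′ eq
    where
    T = Fin (suc W₁) × Fin (suc W₂) × Fin (suc W₃)
    ≤W : ∀ {W} (i : Fin (suc W)) → toℕ i ≤ W
    ≤W = Fin.toℕ≤pred[n]
    t : T → ℕ
    t (i , j , l) = shifted W₁ p₁ n₁ (toℕ i) ℕ.+ shifted W₂ p₂ n₂ (toℕ j) ℕ.+ shifted W₃ p₃ n₃ (toℕ l)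
    t≤ : ∀ w → t w ≤ W₁ ℕ.* h₁ ℕ.+ W₂ ℕ.* h₂ ℕ.+ W₃ ℕ.* h₃
    t≤ (i , j , l) = ℕ.+-mono-≤ (ℕ.+-mono-≤ (shifted-≤ (≤W i) a a′) (shifted-≤ (≤W j) b b′)) (shifted-≤ (≤W l) c c′)
    t-ℤ : ∀ ((i , j , l) : T) → + t (i , j , l) ≡
      + toℕ i * (+ p₁ - + n₁) + + W₁ * + n₁ + (+ toℕ j * (+ p₂ - + n₂) + + W₂ * + n₂)
        + (+ toℕ l * (+ p₃ - + n₃) + + W₃ * + n₃)
    t-ℤ (i , j , l) = trans (ℤ.pos-+ (shifted W₁ p₁ n₁ (toℕ i) ℕ.+ shifted W₂ p₂ n₂ (toℕ j)) _)
      (cong₂ _+_ (trans (ℤ.pos-+ (shifted W₁ p₁ n₁ (toℕ i)) _) (cong₂ _+_ (shifted-ℤ (≤W i)) (shifted-ℤ (≤W j))))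
                 (shifted-ℤ (≤W l)))
    orth : ∀ (w w′ : T) → t w ≡ t w′ →
      pairing (difference w w′) (+ p₁ - + n₁ , + p₂ - + n₂ , + p₃ - + n₃) ≡ 0ℤ
    orth w@(i , j , l) w′@(i′ , j′ , l′) eq =
      pairing-difference (+ toℕ i) (+ toℕ j) (+ toℕ l) (+ toℕ i′) (+ toℕ j′) (+ toℕ l′)
        (+ p₁ - + n₁) (+ p₂ - + n₂) (+ p₃ - + n₃) (+ W₁ * + n₁) (+ W₂ * + n₂) (+ W₃ * + n₃)
        (trans (sym (t-ℤ w)) (trans (cong +_ eq) (t-ℤ w′)))

  -- Enumeration of the possible difference vectors

  symmetricRange : ℕ → List ℤ
  symmetricRange W = map (λ d → + d - + W) (upTo (suc (2 ℕ.* W)))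

  length-symmetricRange : ∀ W → length (symmetricRange W) ≡ suc (2 ℕ.* W)
  length-symmetricRange W = trans (length-map _ (upTo (suc (2 ℕ.* W)))) (length-upTo (suc (2 ℕ.* W)))

  ∈-symmetricRange : ∀ {W} (i j : Fin (suc W)) → + toℕ i - + toℕ j ∈ symmetricRange W
  ∈-symmetricRange {W} i j = subst (_∈ symmetricRange W) eq (∈-map⁺ (λ d → + d - + W) (∈-upTo⁺ (s≤s bound)))
    where
    -- The difference `i - j` sits at index `i + (W ∸ j)` of the range; the subtraction does not
    -- truncate since `j` is at most `W`.
    bound : toℕ i ℕ.+ (W ∸ toℕ j) ≤ 2 ℕ.* W
    bound = ℕ.+-mono-≤ (Fin.toℕ≤pred[n] i) (ℕ.≤-trans (ℕ.m∸n≤m W (toℕ j)) (ℕ.m≤m+n W 0))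
    lem : ∀ i j d → i + d - (j + d) ≡ i - j
    lem = solve-∀
    eq : + (toℕ i ℕ.+ (W ∸ toℕ j)) - + W ≡ + toℕ i - + toℕ j
    eq = trans (cong₂ _-_ (ℤ.pos-+ (toℕ i) (W ∸ toℕ j))
                 (trans (cong +_ (sym (ℕ.m+[n∸m]≡n (Fin.toℕ≤pred[n] j)))) (ℤ.pos-+ (toℕ j) (W ∸ toℕ j))))
               (lem (+ toℕ i) (+ toℕ j) (+ (W ∸ toℕ j)))

  symmetricBox : ℕ → ℕ → ℕ → List (ℤ × ℤ × ℤ)
  symmetricBox W₁ W₂ W₃ = cartesianProduct (symmetricRange W₁) (cartesianProduct (symmetricRange W₂) (symmetricRange W₃))

  length-symmetricBox : ∀ W₁ W₂ W₃ →
    length (symmetricBox W₁ W₂ W₃) ≡ suc (2 ℕ.* W₁) ℕ.* (suc (2 ℕ.* W₂) ℕ.* suc (2 ℕ.* W₃))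
  length-symmetricBox W₁ W₂ W₃ =
    trans (length-cartesianProduct (symmetricRange W₁) (cartesianProduct (symmetricRange W₂) (symmetricRange W₃)))
    (cong₂ ℕ._*_ (length-symmetricRange W₁)
      (trans (length-cartesianProduct (symmetricRange W₂) (symmetricRange W₃))
             (cong₂ ℕ._*_ (length-symmetricRange W₂) (length-symmetricRange W₃))))

  -- Elements of U as roots of trinomials modulo q

  HasSmallMultiple : (q b₁ b₂ b₃ k₁ k₂ k₃ h₁ h₂ h₃ u : ℕ) → Set
  HasSmallMultiple q b₁ b₂ b₃ k₁ k₂ k₃ h₁ h₂ h₃ u = ∃[ s ] (¬ (+ q ∣ₛ + s)) ×
    SmallResidue q h₁ (b₁ ℕ.* u ℕ.^ k₁ ℕ.* s) ×
    SmallResidue q h₂ (b₂ ℕ.* u ℕ.^ k₂ ℕ.* s) ×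
    SmallResidue q h₃ (b₃ ℕ.* u ℕ.^ k₃ ℕ.* s)

  module _ {q : ℕ} (qp : Prime q) {b₁ b₂ b₃ : ℕ}
    (q∤b₁ : ¬ (+ q ∣ₛ + b₁)) (q∤b₂ : ¬ (+ q ∣ₛ + b₂)) (q∤b₃ : ¬ (+ q ∣ₛ + b₃))
    {k₁ k₂ k₃ : ℕ} (k₁≢k₂ : k₁ ≢ k₂) (k₁≢k₃ : k₁ ≢ k₃) (k₂≢k₃ : k₂ ≢ k₃) where

    curve : ℕ → ℤ × ℤ × ℤ
    curve u = + (b₁ ℕ.* u ℕ.^ k₁) , + (b₂ ℕ.* u ℕ.^ k₂) , + (b₃ ℕ.* u ℕ.^ k₃)

    -- The line is the one with coefficients `e` in the projective plane over the field of `q`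
    -- elements. That `e` is nonzero modulo `q` belongs to the relation, because `symmetricBox`
    -- contains the zero vector, whose fibre must be empty.
    OnLine : ℕ → ℤ × ℤ × ℤ → Set
    OnLine u e@(e₁ , e₂ , e₃) =
      (¬ (+ q ∣ₛ e₁ × + q ∣ₛ e₂ × + q ∣ₛ e₃)) × + q ∣ₛ pairing e (curve u)

    -- A number of coefficients large enough for all three monomials; it exceeds each exponent.
    degree : ℕ
    degree = suc (k₁ ℕ.+ k₂ ℕ.+ k₃)

    -- With `degree` or more roots, every coefficient of the trinomial vanishes modulo `q`. As the
    -- exponents differ, the coefficient at `kⱼ` is exactly `eⱼ * bⱼ`, and `bⱼ` is invertible, so
    -- `e` would be zero modulo `q`. A nonempty list is what supplies the contrary fact, through its
    -- first member.
    line-points-≤ : ∀ e us → AllPairs (λ u v → ¬ (+ q ∣ₛ + v - + u)) us →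
      All (λ u → OnLine u e) us → length us ≤ degree
    line-points-≤ e []         ap al = z≤n
    line-points-≤ e@(e₁ , e₂ , e₃) us@(_ ∷ _) ap al@((e≢0 , _) ∷ _) with ℕ.≤-total (length us) degree
    ... | inj₁ ≤d = ≤d
    ... | inj₂ d≤ = ⊥-elim (e≢0
        ( cancel e₁ q∤b₁ (subst (+ q ∣ₛ_) at₁ (vanish k₁ k₁<))
        , cancel e₂ q∤b₂ (subst (+ q ∣ₛ_) at₂ (vanish k₂ k₂<))
        , cancel e₃ q∤b₃ (subst (+ q ∣ₛ_) at₃ (vanish k₃ k₃<))))
      where
      m₁ m₂ m₃ c : ℕ → ℤ
      m₁ = monomial k₁ (e₁ * + b₁)
      m₂ = monomial k₂ (e₂ * + b₂)
      m₃ = monomial k₃ (e₃ * + b₃)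
      c i = m₁ i + m₂ i + m₃ i
      k₁< : k₁ < degree
      k₁< = s≤s (ℕ.≤-trans (ℕ.m≤m+n k₁ k₂) (ℕ.m≤m+n (k₁ ℕ.+ k₂) k₃))
      k₂< : k₂ < degree
      k₂< = s≤s (ℕ.≤-trans (ℕ.m≤n+m k₂ k₁) (ℕ.m≤m+n (k₁ ℕ.+ k₂) k₃))
      k₃< : k₃ < degree
      k₃< = s≤s (ℕ.m≤n+m k₃ (k₁ ℕ.+ k₂))
      term : ∀ e b y → e * + b * + y ≡ e * + (b ℕ.* y)
      term e b y = trans (ℤ.*-assoc e (+ b) (+ y)) (cong (e *_) (sym (ℤ.pos-* b y)))
      mono : ∀ k e b u → k < degree → evalP degree (monomial k (e * + b)) (+ u) ≡ e * + (b ℕ.* u ℕ.^ k)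
      mono k e b u k< = trans (evalP-monomial degree k (e * + b) u k<) (term e b (u ℕ.^ k))
      eval-c : ∀ u → evalP degree c (+ u) ≡ pairing e (curve u)
      eval-c u =
        trans (evalP-+ degree (λ i → m₁ i + m₂ i) m₃ (+ u))
        (cong₂ _+_ (trans (evalP-+ degree m₁ m₂ (+ u)) (cong₂ _+_ (mono k₁ e₁ b₁ u k₁<) (mono k₂ e₂ b₂ u k₂<)))
                   (mono k₃ e₃ b₃ u k₃<))
      vanish : ∀ i → i < degree → + q ∣ₛ c i
      vanish = lagrange qp degree c (map +_ us) (AllPairs.map⁺ ap)
        (All.map⁺ (All.map (λ {u} (_ , d) → subst (+ q ∣ₛ_) (sym (eval-c u)) d) al))
        (subst (degree ≤_) (sym (length-map +_ us)) d≤)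
      at₁ : c k₁ ≡ e₁ * + b₁
      at₁ = trans (cong₂ _+_ (cong₂ _+_ (monomial-≡ k₁ _) (monomial-≢ k₂ _ k₁ (k₁≢k₂ ∘ sym)))
                             (monomial-≢ k₃ _ k₁ (k₁≢k₃ ∘ sym)))
                  (trans (ℤ.+-identityʳ _) (ℤ.+-identityʳ _))
      at₂ : c k₂ ≡ e₂ * + b₂
      at₂ = trans (cong₂ _+_ (cong₂ _+_ (monomial-≢ k₁ _ k₂ k₁≢k₂) (monomial-≡ k₂ _))
                             (monomial-≢ k₃ _ k₂ (k₂≢k₃ ∘ sym)))
                  (trans (ℤ.+-identityʳ _) (ℤ.+-identityˡ _))
      at₃ : c k₃ ≡ e₃ * + b₃
      at₃ = trans (cong₂ _+_ (cong₂ _+_ (monomial-≢ k₁ _ k₃ k₁≢k₃) (monomial-≢ k₂ _ k₃ k₂≢k₃))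
                             (monomial-≡ k₃ _))
                  (ℤ.+-identityˡ _)
      cancel : ∀ e {b} → ¬ (+ q ∣ₛ + b) → + q ∣ₛ e * + b → + q ∣ₛ e
      cancel e {b} q∤b q∣eb = ∣-cancelˡ qp (+ b) q∤b (subst (+ q ∣ₛ_) (ℤ.*-comm e (+ b)) q∣eb)

    -- The witness is the difference of the two box points found by pigeonhole. Their coordinates
    -- lie below `q`, so distinct points are incongruent and the difference is nonzero modulo `q`;
    -- the factor `s` is cancelled because `q` does not divide it.
    small-multiple⇒on-line : ∀ {h₁ h₂ h₃ W₁ W₂ W₃} → W₁ < q → W₂ < q → W₃ < q →
      suc (W₁ ℕ.* h₁ ℕ.+ W₂ ℕ.* h₂ ℕ.+ W₃ ℕ.* h₃) < suc W₁ ℕ.* (suc W₂ ℕ.* suc W₃) →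
      ∀ u → HasSmallMultiple q b₁ b₂ b₃ k₁ k₂ k₃ h₁ h₂ h₃ u → Any (OnLine u) (symmetricBox W₁ W₂ W₃)
    small-multiple⇒on-line {h₁} {h₂} {h₃} {W₁} {W₂} {W₃} W₁<q W₂<q W₃<q B< u
      (s , q∤s , (p₁ , n₁ , p₁≤ , n₁≤ , d₁) , (p₂ , n₂ , p₂≤ , n₂≤ , d₂) , (p₃ , n₃ , p₃≤ , n₃≤ , d₃))
      = go (orthogonal-difference p₁≤ n₁≤ p₂≤ n₂≤ p₃≤ n₃≤ B<)
      where
      T = Fin (suc W₁) × Fin (suc W₂) × Fin (suc W₃)
      x : ℤ × ℤ × ℤ
      x = + p₁ - + n₁ , + p₂ - + n₂ , + p₃ - + n₃
      <q : ∀ {W} → W < q → (i : Fin (suc W)) → toℕ i < q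
      <q W<q i = ℕ.≤-<-trans (Fin.toℕ≤pred[n] i) W<q
      toℕ-≡ : ∀ {W} → W < q → (i i′ : Fin (suc W)) → + q ∣ₛ + toℕ i - + toℕ i′ → i ≡ i′
      toℕ-≡ W<q i i′ d = Fin.toℕ-injective (∣-⇒≡ (<q W<q i) (<q W<q i′) d)
      nonzero : ∀ ((i , j , l) (i′ , j′ , l′) : T) → (i , j , l) ≢ (i′ , j′ , l′) →
        ¬ (+ q ∣ₛ + toℕ i - + toℕ i′ × + q ∣ₛ + toℕ j - + toℕ j′ × + q ∣ₛ + toℕ l - + toℕ l′)
      nonzero (i , j , l) (i′ , j′ , l′) w≢w′ (di , dj , dl) = w≢w′
        (cong₂ _,_ (toℕ-≡ W₁<q i i′ di) (cong₂ _,_ (toℕ-≡ W₂<q j j′ dj) (toℕ-≡ W₃<q l l′ dl)))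
      scaled : ∀ m x → + q ∣ₛ + (m ℕ.* s) - x → + q ∣ₛ + m * + s - x
      scaled m x = subst (λ z → + q ∣ₛ z - x) (ℤ.pos-* m s)
      on : ∀ (w w′ : T) → pairing (difference w w′) x ≡ 0ℤ → + q ∣ₛ pairing (difference w w′) (curve u)
      on (i , j , l) (i′ , j′ , l′) orth = ∣-cancelˡ qp (+ s) q∤s
          (pairing-∣ (+ s) (+ toℕ i - + toℕ i′) (+ toℕ j - + toℕ j′) (+ toℕ l - + toℕ l′)
            (+ p₁ - + n₁) (+ p₂ - + n₂) (+ p₃ - + n₃)
            (+ (b₁ ℕ.* u ℕ.^ k₁)) (+ (b₂ ℕ.* u ℕ.^ k₂)) (+ (b₃ ℕ.* u ℕ.^ k₃))
            (scaled (b₁ ℕ.* u ℕ.^ k₁) (+ p₁ - + n₁) d₁)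
            (scaled (b₂ ℕ.* u ℕ.^ k₂) (+ p₂ - + n₂) d₂)
            (scaled (b₃ ℕ.* u ℕ.^ k₃) (+ p₃ - + n₃) d₃) orth)
      go : (∃₂ λ (w w′ : T) → w ≢ w′ × pairing (difference w w′) x ≡ 0ℤ) → Any (OnLine u) (symmetricBox W₁ W₂ W₃)
      go (w@(i , j , l) , w′@(i′ , j′ , l′) , w≢w′ , orth) = lose
        (∈-cartesianProduct⁺ (∈-symmetricRange i i′)
          (∈-cartesianProduct⁺ (∈-symmetricRange j j′) (∈-symmetricRange l l′)))
        (nonzero w w′ w≢w′ , on w w′ orth)

    count-small-multiples : ∀ {h₁ h₂ h₃ W₁ W₂ W₃} → W₁ < q → W₂ < q → W₃ < q →
      suc (W₁ ℕ.* h₁ ℕ.+ W₂ ℕ.* h₂ ℕ.+ W₃ ℕ.* h₃) < suc W₁ ℕ.* (suc W₂ ℕ.* suc W₃) →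
      ∀ us → AllPairs (λ u v → ¬ (+ q ∣ₛ + v - + u)) us → All (HasSmallMultiple q b₁ b₂ b₃ k₁ k₂ k₃ h₁ h₂ h₃) us →
      length us ≤ suc (2 ℕ.* W₁) ℕ.* (suc (2 ℕ.* W₂) ℕ.* suc (2 ℕ.* W₃)) ℕ.* degree
    count-small-multiples {W₁ = W₁} {W₂} {W₃} W₁<q W₂<q W₃<q B< us ap al =
      subst (λ N → length us ≤ N ℕ.* degree) (length-symmetricBox W₁ W₂ W₃)
        (length-≤-fibres {R = OnLine} line-points-≤ (symmetricBox W₁ W₂ W₃) us ap
          (All.map (λ {u} → small-multiple⇒on-line W₁<q W₂<q W₃<q B< u) al))

-- Choice of the box

open import Data.Nat using (_+_; _*_; _^_; _/_; _%_)
open import Data.Nat.Tactic.RingSolver using (solve-∀)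

-- `H` is the square root of `P` rounded up. In the induction it grows by one exactly when `P` is
-- the square of `H`.
square-between : ∀ P → ∃[ H ] (P ≤ H * H × H * H ≤ 4 * P)
square-between zero = 0 , z≤n , z≤n
square-between (suc P) with square-between P
... | H , P≤H² , H²≤4P with suc P ℕ.≤? H * H
...   | yes 1+P≤H² = H , 1+P≤H² , ℕ.≤-trans H²≤4P (ℕ.*-monoʳ-≤ 4 (ℕ.n≤1+n P))
...   | no  1+P≰H² = suc H , lower , upper
  where
  open ℕ.≤-Reasoning
  H²≡P : H * H ≡ P
  H²≡P = ℕ.≤-antisym (ℕ.≤-pred (ℕ.≰⇒> 1+P≰H²)) P≤H²
  H≤H² : ∀ H → H ≤ H * H
  H≤H² zero    = z≤n
  H≤H² (suc H) = ℕ.m≤m*n (suc H) (suc H)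
  expand : ∀ H → suc H * suc H ≡ 1 + H * H + 2 * H
  expand = solve-∀
  lower : suc P ≤ suc H * suc H
  lower = begin
    suc P               ≡⟨ cong suc (sym H²≡P) ⟩
    1 + H * H           ≤⟨ ℕ.m≤m+n _ (2 * H) ⟩
    1 + H * H + 2 * H   ≡⟨ sym (expand H) ⟩
    suc H * suc H       ∎
  collect : ∀ P → 4 + P + 3 * P ≡ 4 * suc P
  collect = solve-∀
  upper : suc H * suc H ≤ 4 * suc P
  upper = begin
    suc H * suc H       ≡⟨ expand H ⟩
    1 + H * H + 2 * H   ≤⟨ ℕ.+-mono-≤ (ℕ.+-mono-≤ {1} {4} (s≤s z≤n) (ℕ.≤-reflexive H²≡P))
                             (ℕ.*-mono-≤ {2} {3} (s≤s (s≤s z≤n)) (ℕ.≤-trans (H≤H² H) (ℕ.≤-reflexive H²≡P))) ⟩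
    4 + P + 3 * P       ≡⟨ collect P ⟩
    4 * suc P           ∎

m*m<n*n⇒m<n : ∀ m n → m * m < n * n → m < n
m*m<n*n⇒m<n m n m²<n² with n ℕ.≤? m
... | yes n≤m = ⊥-elim (ℕ.<⇒≱ m²<n² (ℕ.*-mono-≤ n≤m n≤m))
... | no  n≰m = ℕ.≰⇒> n≰m

m<[1+m/n]*n : ∀ m n .{{_ : NonZero n}} → m < suc (m / n) * n
m<[1+m/n]*n m n = begin-strict
  m                   ≡⟨ ℕ.m≡m%n+[m/n]*n m n ⟩
  m % n + m / n * n   <⟨ ℕ.+-monoˡ-< (m / n * n) (ℕ.m%n<n m n) ⟩
  n + m / n * n       ∎
  where open ℕ.≤-Reasoning

-- (size · P)² ≤ (5H)⁶ ≤ (25 · 4P)³ in the balanced case, where P = h₁ h₂ h₃.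
abstract
  boxConstant : ℕ
  boxConstant = 100 * (100 * 100)

  16≤boxConstant : 16 ≤ boxConstant
  16≤boxConstant = ℕ.≤ᵇ⇒≤ 16 boxConstant _

  25*25≤boxConstant : 25 * 25 ≤ boxConstant
  25*25≤boxConstant = ℕ.≤ᵇ⇒≤ (25 * 25) boxConstant _

  [100*p]³≡boxConstant*p³ : ∀ p → 100 * p * (100 * p * (100 * p)) ≡ boxConstant * p * (p * p)
  [100*p]³≡boxConstant*p³ = lem 100
    where
    lem : ∀ c p → c * p * (c * p * (c * p)) ≡ c * (c * c) * p * (p * p)
    lem = solve-∀

-- Admissible sides: `large` is the pigeonhole condition, the bounds by `q` keep differences nonzero
-- modulo `q`, and `size` counts the difference vectors. Squaring `size` avoids the square root of
-- the product of the `hⱼ`.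
record Box (q h₁ h₂ h₃ : ℕ) : Set where
  field
    W₁ W₂ W₃ : ℕ
    W₁<q : W₁ < q
    W₂<q : W₂ < q
    W₃<q : W₃ < q
    large : suc (W₁ * h₁ + W₂ * h₂ + W₃ * h₃) < suc W₁ * (suc W₂ * suc W₃)
  size : ℕ
  size = suc (2 * W₁) * (suc (2 * W₂) * suc (2 * W₃))
  field
    size²≤ : size * size ≤ boxConstant * (h₁ * h₂ * h₃)

-- The sides are the integer parts of `2 * H / hⱼ`, with `H` the rounded root of `P`. The sum in
-- `large`, increased by one, is at most `8 * H`, while the box has more than `8 * H` points. The
-- hypothesis on `q` gives `2 * H < q`.
box-balanced : ∀ {q h₁ h₂ h₃} → 1 ≤ h₁ → h₁ ≤ h₂ → h₂ ≤ h₃ → 16 * (h₁ * h₂ * h₃) < q * q →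
  h₃ ≤ h₁ * h₂ → Box q h₁ h₂ h₃
box-balanced {q} {h₁} {h₂} {h₃} 1≤h₁ h₁≤h₂ h₂≤h₃ 16P<q² h₃≤h₁h₂ = record
  { W₁ = W h₁ ; W₂ = W h₂ ; W₃ = W h₃
  ; W₁<q = W<q h₁ ; W₂<q = W<q h₂ ; W₃<q = W<q h₃
  ; large = large
  ; size²≤ = size²≤
  }
  where
  open ℕ.≤-Reasoning
  P H : ℕ
  P = h₁ * h₂ * h₃
  H = proj₁ (square-between P)
  P≤H² : P ≤ H * H
  P≤H² = proj₁ (proj₂ (square-between P))
  H²≤4P : H * H ≤ 4 * P
  H²≤4P = proj₂ (proj₂ (square-between P))
  instance
    h₁≢0 : NonZero h₁
    h₁≢0 = ℕ.>-nonZero 1≤h₁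
    h₂≢0 : NonZero h₂
    h₂≢0 = ℕ.>-nonZero (ℕ.≤-trans 1≤h₁ h₁≤h₂)
    h₃≢0 : NonZero h₃
    h₃≢0 = ℕ.>-nonZero (ℕ.≤-trans 1≤h₁ (ℕ.≤-trans h₁≤h₂ h₂≤h₃))
    P≢0 : NonZero P
    P≢0 = ℕ.m*n≢0 (h₁ * h₂) h₃ {{ℕ.m*n≢0 h₁ h₂}}
    P²≢0 : NonZero (P * P)
    P²≢0 = ℕ.m*n≢0 P P
  W : ∀ h .{{_ : NonZero h}} → ℕ
  W h = 2 * H / h
  2H<q : 2 * H < q
  2H<q = m*m<n*n⇒m<n (2 * H) q (begin-strict
    2 * H * (2 * H)   ≡⟨ lem H ⟩
    4 * (H * H)       ≤⟨ ℕ.*-monoʳ-≤ 4 H²≤4P ⟩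
    4 * (4 * P)       ≡⟨ sym (ℕ.*-assoc 4 4 P) ⟩
    16 * P            <⟨ 16P<q² ⟩
    q * q             ∎)
    where
    lem : ∀ H → 2 * H * (2 * H) ≡ 4 * (H * H)
    lem = solve-∀
  W<q : ∀ h .{{_ : NonZero h}} → W h < q
  W<q h = ℕ.≤-<-trans (ℕ.m/n≤m (2 * H) h) 2H<q
  W*h≤ : ∀ h .{{_ : NonZero h}} → W h * h ≤ 2 * H
  W*h≤ h = ℕ.m/n*n≤m (2 * H) h
  instance
    H≢0 : NonZero H
    H≢0 = ℕ.≢-nonZero λ H≡0 → ℕ.<⇒≱ (ℕ.>-nonZero⁻¹ P) (ℕ.≤-trans P≤H² (ℕ.≤-reflexive (cong (λ x → x * x) H≡0)))
  -- The balance condition enters here. Since every `hⱼ` is at most `H`, the `1` in `suc (2 * W hⱼ)`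
  -- costs at most another `H` after multiplication by `hⱼ`, which yields the bound `5 * H` per
  -- side.
  h₃≤H : h₃ ≤ H
  h₃≤H with h₃ ℕ.≤? H
  ... | yes p = p
  ... | no  p = ⊥-elim (ℕ.<⇒≱ (ℕ.*-mono-< (ℕ.≰⇒> p) (ℕ.≰⇒> p)) (begin
    h₃ * h₃          ≤⟨ ℕ.*-monoˡ-≤ h₃ h₃≤h₁h₂ ⟩
    h₁ * h₂ * h₃     ≤⟨ P≤H² ⟩
    H * H            ∎))
  interchange : ∀ a b c x y z → a * x * (b * y * (c * z)) ≡ a * (b * c) * (x * y * z)
  interchange = solve-∀
  -- Multiplying by `P` undoes the rounding: each `suc (W hⱼ) * hⱼ` exceeds `2 * H`, and the cube of
  -- `2 * H` is at least `8 * H * P`.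
  8H<box : 8 * H < suc (W h₁) * (suc (W h₂) * suc (W h₃))
  8H<box = ℕ.*-cancelʳ-< P (8 * H) _ (begin-strict
    8 * H * P                       ≤⟨ ℕ.*-monoʳ-≤ (8 * H) P≤H² ⟩
    8 * H * (H * H)                 ≡⟨ lem H ⟩
    2 * H * (2 * H * (2 * H))       <⟨ ℕ.*-mono-< (m<[1+m/n]*n (2 * H) h₁)
                                         (ℕ.*-mono-< (m<[1+m/n]*n (2 * H) h₂) (m<[1+m/n]*n (2 * H) h₃)) ⟩
    suc (W h₁) * h₁ * (suc (W h₂) * h₂ * (suc (W h₃) * h₃))
      ≡⟨ interchange (suc (W h₁)) (suc (W h₂)) (suc (W h₃)) h₁ h₂ h₃ ⟩
    suc (W h₁) * (suc (W h₂) * suc (W h₃)) * P ∎)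
    where
    lem : ∀ H → 8 * H * (H * H) ≡ 2 * H * (2 * H * (2 * H))
    lem = solve-∀
  large : suc (W h₁ * h₁ + W h₂ * h₂ + W h₃ * h₃) < suc (W h₁) * (suc (W h₂) * suc (W h₃))
  large = begin-strict
    1 + (W h₁ * h₁ + W h₂ * h₂ + W h₃ * h₃)
      ≤⟨ ℕ.+-mono-≤ (ℕ.≤-trans (ℕ.>-nonZero⁻¹ H) (ℕ.m≤m+n H (1 * H)))
           (ℕ.+-mono-≤ (ℕ.+-mono-≤ (W*h≤ h₁) (W*h≤ h₂)) (W*h≤ h₃)) ⟩
    2 * H + (2 * H + 2 * H + 2 * H)   ≡⟨ lem H ⟩
    8 * H                             <⟨ 8H<box ⟩
    suc (W h₁) * (suc (W h₂) * suc (W h₃)) ∎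
    where
    lem : ∀ H → 2 * H + (2 * H + 2 * H + 2 * H) ≡ 8 * H
    lem = solve-∀
  side≤ : ∀ h .{{_ : NonZero h}} → h ≤ H → suc (2 * W h) * h ≤ 5 * H
  side≤ h h≤H = begin
    h + 2 * W h * h     ≡⟨ cong (λ x → h + x) (ℕ.*-assoc 2 (W h) h) ⟩
    h + 2 * (W h * h)   ≤⟨ ℕ.+-mono-≤ h≤H (ℕ.*-monoʳ-≤ 2 (W*h≤ h)) ⟩
    H + 2 * (2 * H)     ≡⟨ lem H ⟩
    5 * H               ∎
    where
    lem : ∀ H → H + 2 * (2 * H) ≡ 5 * H
    lem = solve-∀
  A = suc (2 * W h₁) * (suc (2 * W h₂) * suc (2 * W h₃))
  A*P≤ : A * P ≤ 5 * H * (5 * H * (5 * H))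
  A*P≤ = begin
    A * P ≡⟨ sym (interchange (suc (2 * W h₁)) (suc (2 * W h₂)) (suc (2 * W h₃)) h₁ h₂ h₃) ⟩
    suc (2 * W h₁) * h₁ * (suc (2 * W h₂) * h₂ * (suc (2 * W h₃) * h₃))
      ≤⟨ ℕ.*-mono-≤ (side≤ h₁ (ℕ.≤-trans (ℕ.≤-trans h₁≤h₂ h₂≤h₃) h₃≤H))
           (ℕ.*-mono-≤ (side≤ h₂ (ℕ.≤-trans h₂≤h₃ h₃≤H)) (side≤ h₃ h₃≤H)) ⟩
    5 * H * (5 * H * (5 * H)) ∎
  25H²≤100P : 5 * H * (5 * H) ≤ 100 * P
  25H²≤100P = begin
    5 * H * (5 * H)   ≡⟨ lem H ⟩
    25 * (H * H)      ≤⟨ ℕ.*-monoʳ-≤ 25 H²≤4P ⟩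
    25 * (4 * P)      ≡⟨ sym (ℕ.*-assoc 25 4 P) ⟩
    100 * P           ∎
    where
    lem : ∀ H → 5 * H * (5 * H) ≡ 25 * (H * H)
    lem = solve-∀
  size²≤ : A * A ≤ boxConstant * P
  size²≤ = ℕ.*-cancelʳ-≤ (A * A) (boxConstant * P) (P * P) {{P²≢0}} (begin
    A * A * (P * P)                       ≡⟨ ℕ.[m*n]*[o*p]≡[m*o]*[n*p] A A P P ⟩
    A * P * (A * P)                       ≤⟨ ℕ.*-mono-≤ A*P≤ A*P≤ ⟩
    5 * H * (5 * H * (5 * H)) * (5 * H * (5 * H * (5 * H)))
                                          ≡⟨ lem (5 * H) ⟩
    X * (X * X)                           ≤⟨ ℕ.*-mono-≤ 25H²≤100P (ℕ.*-mono-≤ 25H²≤100P 25H²≤100P) ⟩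
    100 * P * (100 * P * (100 * P))       ≡⟨ [100*p]³≡boxConstant*p³ P ⟩
    boxConstant * P * (P * P)       ∎)
    where
    X = 5 * H * (5 * H)
    lem : ∀ y → y * (y * y) * (y * (y * y)) ≡ y * y * (y * y * (y * y))
    lem = solve-∀

-- With the third side zero only the first two coordinates are combined. The box has
-- `4 * h₁ * h₂ + 2 * h₁ + 2 * h₂ + 1` points against `4 * h₁ * h₂ + 1` values. Its `size` is at
-- most `25 * (h₁ * h₂)`, and the square of `h₁ * h₂` is at most `P` because `h₁ * h₂ ≤ h₃`.
box-unbalanced : ∀ {q h₁ h₂ h₃} → 1 ≤ h₁ → h₁ ≤ h₂ → h₂ ≤ h₃ → 16 * (h₁ * h₂ * h₃) < q * q →
  h₁ * h₂ ≤ h₃ → Box q h₁ h₂ h₃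
box-unbalanced {q} {h₁} {h₂} {h₃} 1≤h₁ h₁≤h₂ h₂≤h₃ 16P<q² h₁h₂≤h₃ = record
  { W₁ = 2 * h₂ ; W₂ = 2 * h₁ ; W₃ = 0
  ; W₁<q = 2h₂<q
  ; W₂<q = ℕ.≤-<-trans (ℕ.*-monoʳ-≤ 2 h₁≤h₂) 2h₂<q
  ; W₃<q = ℕ.≤-<-trans z≤n 2h₂<q
  ; large = large
  ; size²≤ = size²≤
  }
  where
  open ℕ.≤-Reasoning
  2h₂<q : 2 * h₂ < q
  2h₂<q = m*m<n*n⇒m<n (2 * h₂) q (begin-strict
    2 * h₂ * (2 * h₂)          ≡⟨ lem h₂ ⟩
    4 * (1 * h₂ * h₂)          ≤⟨ ℕ.*-mono-≤ {4} {16} (ℕ.≤ᵇ⇒≤ 4 16 _) (ℕ.*-mono-≤ (ℕ.*-monoˡ-≤ h₂ 1≤h₁) h₂≤h₃) ⟩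
    16 * (h₁ * h₂ * h₃)        <⟨ 16P<q² ⟩
    q * q                      ∎)
    where
    lem : ∀ h → 2 * h * (2 * h) ≡ 4 * (1 * h * h)
    lem = solve-∀
  large : suc (2 * h₂ * h₁ + 2 * h₁ * h₂ + 0) < suc (2 * h₂) * (suc (2 * h₁) * 1)
  large = begin-strict
    suc (2 * h₂ * h₁ + 2 * h₁ * h₂ + 0)                   <⟨ ℕ.m<m+n _ (ℕ.≤-trans 1≤h₁ (ℕ.≤-trans (ℕ.m≤m+n h₁ (1 * h₁)) (ℕ.m≤m+n (2 * h₁) (2 * h₂)))) ⟩
    suc (2 * h₂ * h₁ + 2 * h₁ * h₂ + 0) + (2 * h₁ + 2 * h₂) ≡⟨ lem h₁ h₂ ⟩
    suc (2 * h₂) * (suc (2 * h₁) * 1)                     ∎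
    where
    lem : ∀ x y → suc (2 * y * x + 2 * x * y + 0) + (2 * x + 2 * y) ≡ suc (2 * y) * (suc (2 * x) * 1)
    lem = solve-∀
  side≤ : ∀ h → 1 ≤ h → suc (2 * (2 * h)) ≤ 5 * h
  side≤ h 1≤h = begin
    1 + 2 * (2 * h)   ≤⟨ ℕ.+-monoˡ-≤ (2 * (2 * h)) 1≤h ⟩
    h + 2 * (2 * h)   ≡⟨ lem h ⟩
    5 * h             ∎
    where
    lem : ∀ h → h + 2 * (2 * h) ≡ 5 * h
    lem = solve-∀
  A = suc (2 * (2 * h₂)) * (suc (2 * (2 * h₁)) * 1)
  A≤ : A ≤ 25 * (h₁ * h₂)
  A≤ = begin
    A                        ≤⟨ ℕ.*-mono-≤ (side≤ h₂ (ℕ.≤-trans 1≤h₁ h₁≤h₂)) (ℕ.*-monoˡ-≤ 1 (side≤ h₁ 1≤h₁)) ⟩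
    5 * h₂ * (5 * h₁ * 1)    ≡⟨ lem h₁ h₂ ⟩
    25 * (h₁ * h₂)           ∎
    where
    lem : ∀ x y → 5 * y * (5 * x * 1) ≡ 25 * (x * y)
    lem = solve-∀
  size²≤ : A * A ≤ boxConstant * (h₁ * h₂ * h₃)
  size²≤ = begin
    A * A                                 ≤⟨ ℕ.*-mono-≤ A≤ A≤ ⟩
    25 * (h₁ * h₂) * (25 * (h₁ * h₂))     ≡⟨ ℕ.[m*n]*[o*p]≡[m*o]*[n*p] 25 (h₁ * h₂) 25 (h₁ * h₂) ⟩
    25 * 25 * (h₁ * h₂ * (h₁ * h₂))       ≤⟨ ℕ.*-mono-≤ 25*25≤boxConstant
                                               (ℕ.*-monoʳ-≤ (h₁ * h₂) h₁h₂≤h₃) ⟩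
    boxConstant * (h₁ * h₂ * h₃)    ∎

box : ∀ {q h₁ h₂ h₃} → 1 ≤ h₁ → h₁ ≤ h₂ → h₂ ≤ h₃ → 16 * (h₁ * h₂ * h₃) < q * q → Box q h₁ h₂ h₃
box {h₁ = h₁} {h₂} {h₃} 1≤h₁ h₁≤h₂ h₂≤h₃ 16P<q² with ℕ.≤-total h₃ (h₁ * h₂)
... | inj₁ p = box-balanced 1≤h₁ h₁≤h₂ h₂≤h₃ 16P<q² p
... | inj₂ p = box-unbalanced 1≤h₁ h₁≤h₂ h₂≤h₃ 16P<q² p

-- The bound for the cardinality of U

∤⇒∤% : ∀ q .{{_ : NonZero q}} a → ¬ ((+ q) ∣ a) → ¬ (+ q ∣ₛ + (a %ℕ q))
∤⇒∤% q a q∤a q∣r = q∤a (∣⇒∣ᵤ (subst (+ q ∣ₛ_) (sym (a≡a%ℕn+[a/ℕn]*n a q)) (∣m∣n⇒∣m+n q∣r (divides (a /ℕ q) refl))))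

1≤⌊log₂⌋ : ∀ {n} → 2 ≤ n → 1 ≤ ⌊log₂ n ⌋
1≤⌊log₂⌋ {n} 2≤n = subst (_≤ ⌊log₂ n ⌋) (⌊log₂[2^n]⌋≡n 1) (⌊log₂⌋-mono-≤ 2≤n)

module _ {m : ℕ} (k : Fin (3 + m) → ℕ) (k-distinct : ∀ i j → i ≢ j → k i ≢ k j)
  {q : ℕ} (qp : Prime q) (a : Fin (3 + m) → ℤ) (q∤a : ∀ i → ¬ ((+ q) ∣ a i)) (h : Fin (3 + m) → ℕ) where

  private instance
    q≢0 : NonZero q
    q≢0 = prime⇒nonZero qp

  private
    j₁ j₂ j₃ : Fin (3 + m)
    j₁ = zero
    j₂ = suc zero
    j₃ = suc (suc zero)
    q∤b : ∀ j → ¬ (+ q ∣ₛ + (a j %ℕ q))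
    q∤b j = ∤⇒∤% q (a j) (q∤a j)

  #U≤q : #U q a k h ≤ q
  #U≤q = ℕ.≤-trans (length-filter (InU? q a k h) (upTo q)) (ℕ.≤-reflexive (length-upTo q))

  #U≤size : (B : Box q (h j₁) (h j₂) (h j₃)) → #U q a k h ≤ Box.size B * suc (k j₁ + k j₂ + k j₃)
  #U≤size B = count-small-multiples qp (q∤b j₁) (q∤b j₂) (q∤b j₃)
      (k-distinct j₁ j₂ λ ()) (k-distinct j₁ j₃ λ ()) (k-distinct j₂ j₃ λ ())
      W₁<q W₂<q W₃<q large (filter (InU? q a k h) (upTo q))
      (AllPairs.filter⁺ (InU? q a k h) (AllPairs.applyUpTo⁺₁ id q
        λ i<j j<q q∣j-i → ℕ.<⇒≢ i<j (sym (∣-⇒≡ j<q (ℕ.<-trans i<j j<q) q∣j-i))))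
      (All.map (λ {u} → small u) (All.all-filter (InU? q a k h) (upTo q)))
    where
    open Box B
    small : ∀ u → InU q a k h u → HasSmallMultiple q (a j₁ %ℕ q) (a j₂ %ℕ q) (a j₃ %ℕ q)
      (k j₁) (k j₂) (k j₃) (h j₁) (h j₂) (h j₃) u
    small u inU with find inU
    ... | s , s∈ , bohr with ∈-map⁻ suc s∈
    ...   | i , i∈ , refl = suc i , q∤s , res j₁ , res j₂ , res j₃
      where
      res = λ j → distq⇒small q ((a j %ℕ q) * u ^ k j * suc i) (bohr j)
      q∤s : ¬ (+ q ∣ₛ + suc i)
      -- Here `i` is below `q ∸ 1`, so `suc i` is positive and below `q`.
      q∤s q∣s = ℕ.<⇒≱ (ℕ.<-≤-trans (s≤s (∈-upTo⁻ i∈)) (ℕ.≤-reflexive (ℕ.suc-pred q))) (ℕ.∣⇒≤ (∣⇒∣ᵤ q∣s))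

  #U²≤ : 1 ≤ h j₁ → h j₁ ≤ h j₂ → h j₂ ≤ h j₃ → let K = suc (k j₁ + k j₂ + k j₃) in
    #U q a k h ^ 2 ≤ boxConstant * (K * K) * (h j₁ * h j₂ * h j₃)
  #U²≤ 1≤h₁ h₁≤h₂ h₂≤h₃ with 16 * (h j₁ * h j₂ * h j₃) ℕ.<? q * q
  -- No box below `q` is available in this range, but the trivial bound by `q` is already of the
  -- order of the root of `P`.
  ... | no  q²≤16P = begin
    N ^ 2                             ≡⟨ cong (N *_) (ℕ.*-identityʳ N) ⟩
    N * N                             ≤⟨ ℕ.*-mono-≤ #U≤q #U≤q ⟩
    q * q                             ≤⟨ ℕ.≮⇒≥ q²≤16P ⟩
    16 * P                            ≤⟨ ℕ.*-monoˡ-≤ P 16≤boxConstant ⟩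
    boxConstant * P                             ≤⟨ ℕ.*-monoˡ-≤ P (ℕ.m≤m*n boxConstant (K * K)) ⟩
    boxConstant * (K * K) * P                   ∎
    where
    open ℕ.≤-Reasoning
    N = #U q a k h
    P = h j₁ * h j₂ * h j₃
    K = suc (k j₁ + k j₂ + k j₃)
  ... | yes 16P<q² = begin
    N ^ 2                             ≡⟨ cong (N *_) (ℕ.*-identityʳ N) ⟩
    N * N                             ≤⟨ ℕ.*-mono-≤ (#U≤size B) (#U≤size B) ⟩
    A * K * (A * K)                   ≡⟨ ℕ.[m*n]*[o*p]≡[m*o]*[n*p] A K A K ⟩
    A * A * (K * K)                   ≤⟨ ℕ.*-monoˡ-≤ (K * K) (Box.size²≤ B) ⟩
    boxConstant * P * (K * K)                   ≡⟨ lem boxConstant P (K * K) ⟩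
    boxConstant * (K * K) * P                   ∎
    where
    open ℕ.≤-Reasoning
    B = box 1≤h₁ h₁≤h₂ h₂≤h₃ 16P<q²
    A = Box.size B
    N = #U q a k h
    P = h j₁ * h j₂ * h j₃
    K = suc (k j₁ + k j₂ + k j₃)
    lem : ∀ x y z → x * y * z ≡ x * z * y
    lem = solve-∀

theorem2p1 : (m : ℕ) → let n = 3 + m in
    (k : Fin n → ℕ) → (∀ i → 0 < k i) → (∀ i j → i ≢ j → k i ≢ k j) →
    ∃[ C ] ((q : ℕ) → (qp : Prime q) →
    (a : Fin n → ℤ) → (∀ i → ¬ ((+ q) ∣ a i)) →
    (h : Fin n → ℕ) → (∀ i → 1 ≤ h i) → (∀ i j → Data.Fin._≤_ i j → h i ≤ h j) →
    #U q {{prime⇒nonZero qp}} a k h ^ 2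
    ≤ C * (h zero * h (suc zero) * h (suc (suc zero))) * ⌊log₂ q ⌋ ^ 2)
-- The constant is fixed before `q`, `a` and `h`: `K` bounds the roots of one trinomial, and its
-- square appears because the whole estimate is squared. Since `q` is at least 2, its binary
-- logarithm is at least 1, so the logarithmic factor only enlarges the right side.
theorem2p1 m k _ k-distinct = boxConstant * (K * K) , λ q qp a q∤a h 1≤h h-mono →
  ℕ.≤-trans (#U²≤ k k-distinct qp a q∤a h (1≤h zero) (h-mono _ _ z≤n) (h-mono _ _ (s≤s z≤n)))
            (ℕ.m≤m*n _ (⌊log₂ q ⌋ ^ 2) {{ℕ.>-nonZero (ℕ.m^n>0 ⌊log₂ q ⌋
              {{ℕ.>-nonZero (1≤⌊log₂⌋ (ℕ.nonTrivial⇒n>1 q {{prime⇒nonTrivial qp}}))}} 2)}})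
  where
  K = suc (k zero + k (suc zero) + k (suc (suc zero)))
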